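{- Let $k$ be a non-negative integer and let $m,\alpha,\beta\ge 1$ be integers with $2\nmid\alpha$. Let $p\ge 3$ be a prime such that $p\equiv 3\pmod 4$. Then for all integers $n\ge 0$, $$\bar a_{2^m\alpha}\left(4p^{2k}n+p^{2k}\right)\equiv (p^2)^k\,\bar a_{2^m\alpha}(4n+1)\pmod{2^{m+2}},$$ $$\bar a_{2\beta+1}\left(4p^{2k}n+p^{2k}\right)\equiv (p^2)^k\,\bar a_{2\beta+1}(4n+1)\pmod 4.$$
   Context: For integers $\ell\ge1$ write $f_\ell=\prod_{j\ge 1}(1-q^{\ell j})$. For a positive integer $s$, $\bar a_s(n)$ denotes the number of partitions of $n$ in which each odd part occurs in one of $s$ colors and the first occurrence of each part (parts of the same size but different colors being distinct) may be overlined. Equivalently, $$\sum_{n\ge0}\bar a_s(n)q^n=\frac{f_2^{3s-2}}{f_1^{2s}f_4^{s-1}}.$$ -}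

module Defs where

open import Data.Bool using (Bool; true; false; if_then_else_)
open import Data.Fin using (Fin)
open import Data.Integer as ℤ using (+_)
import Data.Integer.Divisibility as ℤ
open import Data.List using (List; []; _∷_; map; concatMap; cartesianProductWith; filter; length; upTo; allFin)
open import Data.Nat using (ℕ; suc; _*_; _≟_)
open import Data.Nat.Divisibility using (_∣?_)
open import Data.Nat.ListAction using (sum)
open import Data.Product using (Σ; _×_; _,_)
open import Relation.Nullary using (does)

infix 4 _≡_[mod_]

_≡_[mod_] : ℕ → ℕ → ℕ → Set
a ≡ b [mod m ] = + m ℤ.∣ (+ a ℤ.- + b)

colours : ℕ → ℕ → ℕ
colours s i = if does (2 ∣? i) then 1 else s

-- A part is a size together with a colour; parts of equal size and different
-- colours are different parts.
Part : ℕ → Set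
Part s = Σ ℕ λ i → Fin (colours s i)

-- The distinct parts of size 1, …, n, i.e. all those usable in a partition of n.
parts : (s n : ℕ) → List (Part s)
parts s n = concatMap (λ i → map (i ,_) (allFin (colours s i))) (map suc (upTo n))

-- How a given part occurs in a partition: not at all, or t + 1 times (occurs t b),
-- its first occurrence being overlined exactly when b is true.
data Occurrence : Set where
  absent : Occurrence
  occurs : (t : ℕ) (overlined : Bool) → Occurrence

multiplicity : Occurrence → ℕ
multiplicity absent       = 0
multiplicity (occurs t _) = suc t

-- Every Occurrence of multiplicity at most n.
occurrences : ℕ → List Occurrence
occurrences n = absent ∷ cartesianProductWith occurs (upTo n) (true ∷ false ∷ [])

-- A partition is a multiset of parts, so it is given by choosing an Occurrence
-- for each available part.
choices : ∀ {s} → ℕ → List (Part s) → List (List (Part s × Occurrence))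
choices n []       = [] ∷ []
choices n (p ∷ ps) = cartesianProductWith (λ o π → (p , o) ∷ π) (occurrences n) (choices n ps)

weight : ∀ {s} → List (Part s × Occurrence) → ℕ
weight π = sum (map (λ { ((i , _) , o) → multiplicity o * i }) π)

-- Since all sizes are positive, a partition of n has only parts of size and
-- multiplicity at most n, so the bounds in parts and choices exclude nothing.
partitions : (s n : ℕ) → List (List (Part s × Occurrence))
partitions s n = filter (λ π → weight π ≟ n) (choices n (parts s n))

-- ā s n is the number of partitions of n in which each odd part has one of s
-- colours and the first occurrence of each part may be overlined.
ā : ℕ → ℕ → ℕ
ā s n = length (partitions s n)

{-# OPTIONS --safe #-}
module Submission where

-- A part of size i contributes the factor 1 + 2 Gᵢ, where Gᵢ = q^i + q^2i + …, to
-- the generating function.  Modulo 2^(m+2) and for odd α,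
--   (1 + 2 Gᵢ)^(2^m α) ≡ 1 + 2^(m+1) (Gᵢ + Gᵢ²),
-- and the coefficients of Gᵢ² at odd exponents are even; the even sizes contribute
-- an even power series which is 1 modulo 2.  So for odd N the coefficient ā(N) is
-- 2^(m+1) d(N), with d(N) the number of divisors of N.  With an odd number of
-- colours the same argument modulo 4 gives 2 d(N).  Since d(N) is odd exactly when N
-- is a square, ā(N) only depends on whether N is a square, which multiplication by
-- the odd number p^(2k) does not change.

open import Defs
open import Data.Nat using (ℕ; _+_; _*_; _^_; _≤_)
open import Data.Nat.Divisibility using (_∤_)
open import Data.Nat.Primality using (Prime)
open import Data.Product using (_×_)

open import Data.Bool using (true; false; if_then_else_)
open import Data.Empty using (⊥-elim)
open import Data.Fin using (Fin)
open import Data.Integer using () renaming (+_ to pos)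
import Data.Integer as ℤ
import Data.Integer.Divisibility.Signed as ℤˢ
import Data.Integer.Properties as ℤ
import Data.Integer.Tactic.RingSolver as ℤ-Ring
open import Data.List
  using (List; []; _∷_; _++_; map; concatMap; cartesianProductWith; filter; length; applyUpTo; upTo; allFin)
open import Data.List.Properties
  using (map-∘; map-upTo; filter-++; filter-accept; filter-reject; length-++; length-tabulate)
open import Data.Nat using (zero; suc; _≟_; s≤s; NonZero; _<_)
open import Data.Nat.Divisibility
  using (_∣_; _∣?_; divides; ∣m∣n⇒∣m+n; ∣m+n∣m⇒∣n; n∣m*n; m∣m*n; ∣m⇒∣m*n; ∣n⇒∣m*n; ∣1⇒≡1)
open import Data.Nat.GeneralisedArithmetic using (fold; fold-+)
open import Data.Nat.ListAction using (sum)
open import Data.Nat.Primality using (euclidsLemma; prime[2]; prime⇒irreducible; prime⇒nonZero)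
open import Data.Nat.Properties
open import Data.Nat.Tactic.RingSolver using (solve-∀)
open import Data.Product using (Σ; _,_; proj₁; proj₂; ∃)
open import Data.Sum using (_⊎_; inj₁; inj₂; [_,_]′; reduce)
open import Function using (_∘_; id)
open import Relation.Binary.Bundles using (Setoid)
open import Relation.Binary.Definitions using (tri<; tri≈; tri>)
open import Relation.Binary.PropositionalEquality
import Relation.Binary.Reasoning.Setoid as SetoidReasoning
open import Relation.Nullary using (¬_; Dec; yes; no)
open import Relation.Nullary.Decidable using (map′; dec-true; dec-false)

-- Congruences between natural numbers

infix 4 _≋_[_]

-- The same relation as _≡_[mod_], but without subtraction and, being a record,
-- with a and b recoverable by unification.
record _≋_[_] (a b M : ℕ) : Set where
  constructor cong-by
  field
    x y : ℕ
    eq  : a + x * M ≡ b + y * M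

≋⇒≡mod : ∀ {M a b} → a ≋ b [ M ] → a ≡ b [mod M ]
≋⇒≡mod {M} {a} {b} (cong-by x y eq) =
  -- From `a + x * M ≡ b + y * M`, the quotient of `a - b` by `M` is `y - x`.
  ℤˢ.∣⇒∣ᵤ {pos M} {pos a ℤ.- pos b} (ℤˢ.divides (pos y ℤ.- pos x) (begin
    pos a ℤ.- pos b
      ≡⟨ insert (pos a) (pos b) (pos x) (pos M) ⟩
    (pos a ℤ.+ pos x ℤ.* pos M) ℤ.- (pos b ℤ.+ pos x ℤ.* pos M)
      ≡⟨ cong (ℤ._- (pos b ℤ.+ pos x ℤ.* pos M)) lifted ⟩
    (pos b ℤ.+ pos y ℤ.* pos M) ℤ.- (pos b ℤ.+ pos x ℤ.* pos M)
      ≡⟨ collect (pos b) (pos x) (pos y) (pos M) ⟩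
    (pos y ℤ.- pos x) ℤ.* pos M ∎))
  where
  open ≡-Reasoning
  insert : ∀ a b x M → a ℤ.- b ≡ (a ℤ.+ x ℤ.* M) ℤ.- (b ℤ.+ x ℤ.* M)
  insert = ℤ-Ring.solve-∀
  collect : ∀ b x y M → (b ℤ.+ y ℤ.* M) ℤ.- (b ℤ.+ x ℤ.* M) ≡ (y ℤ.- x) ℤ.* M
  collect = ℤ-Ring.solve-∀
  pos-linear : ∀ a x → pos (a + x * M) ≡ pos a ℤ.+ pos x ℤ.* pos M
  pos-linear a x = cong (λ z → pos a ℤ.+ z) (ℤ.pos-* x M)
  lifted : pos a ℤ.+ pos x ℤ.* pos M ≡ pos b ℤ.+ pos y ℤ.* pos M
  lifted = trans (sym (pos-linear a x)) (trans (cong pos eq) (pos-linear b y))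

≋-reflexive : ∀ {M a b} → a ≡ b → a ≋ b [ M ]
≋-reflexive a≡b = cong-by 0 0 (cong (_+ 0) a≡b)

≋-refl : ∀ {M a} → a ≋ a [ M ]
≋-refl = ≋-reflexive refl

≋-sym : ∀ {M a b} → a ≋ b [ M ] → b ≋ a [ M ]
≋-sym (cong-by x y eq) = cong-by y x (sym eq)

≋-trans : ∀ {M a b c} → a ≋ b [ M ] → b ≋ c [ M ] → a ≋ c [ M ]
≋-trans {M} {a} {b} {c} (cong-by x y p) (cong-by z w q) = cong-by (x + z) (y + w) (begin
  a + (x + z) * M      ≡⟨ split a x z M ⟩
  (a + x * M) + z * M  ≡⟨ cong (_+ z * M) p ⟩
  (b + y * M) + z * M  ≡⟨ swap b y z M ⟩
  (b + z * M) + y * M  ≡⟨ cong (_+ y * M) q ⟩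
  (c + w * M) + y * M  ≡⟨ swap c w y M ⟩
  (c + y * M) + w * M  ≡⟨ split c y w M ⟨
  c + (y + w) * M      ∎)
  where
  open ≡-Reasoning
  split : ∀ a x z M → a + (x + z) * M ≡ (a + x * M) + z * M
  split = solve-∀
  swap : ∀ b y z M → (b + y * M) + z * M ≡ (b + z * M) + y * M
  swap = solve-∀

≋-setoid : ℕ → Setoid _ _
≋-setoid M = record
  { Carrier = ℕ
  ; _≈_ = λ a b → a ≋ b [ M ]
  ; isEquivalence = record { refl = ≋-refl ; sym = ≋-sym ; trans = ≋-trans }
  }

module ≋-Reasoning (M : ℕ) = SetoidReasoning (≋-setoid M)

≋-+ : ∀ {M a b c d} → a ≋ b [ M ] → c ≋ d [ M ] → a + c ≋ b + d [ M ]
≋-+ {M} {a} {b} {c} {d} (cong-by x y p) (cong-by z w q) = cong-by (x + z) (y + w) (begin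
  a + c + (x + z) * M        ≡⟨ split a c x z M ⟩
  (a + x * M) + (c + z * M)  ≡⟨ cong₂ _+_ p q ⟩
  (b + y * M) + (d + w * M)  ≡⟨ split b d y w M ⟨
  b + d + (y + w) * M        ∎)
  where
  open ≡-Reasoning
  split : ∀ a c x z M → a + c + (x + z) * M ≡ (a + x * M) + (c + z * M)
  split = solve-∀

≋-scale : ∀ {M a b} c → a ≋ b [ M ] → c * a ≋ c * b [ c * M ]
≋-scale {M} {a} {b} c (cong-by x y p) = cong-by x y (begin
  c * a + x * (c * M)  ≡⟨ factor c a x M ⟨
  c * (a + x * M)      ≡⟨ cong (c *_) p ⟩
  c * (b + y * M)      ≡⟨ factor c b y M ⟩
  c * b + y * (c * M)  ∎)
  where
  open ≡-Reasoning
  factor : ∀ c a x M → c * (a + x * M) ≡ c * a + x * (c * M)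
  factor = solve-∀

≋-∣ : ∀ {M M′ a b} → M ∣ M′ → a ≋ b [ M′ ] → a ≋ b [ M ]
≋-∣ {M} {_} {a} {b} (divides c refl) (cong-by x y p) = cong-by (x * c) (y * c)
  (trans (cong (a +_) (*-assoc x c M)) (trans p (cong (b +_) (sym (*-assoc y c M)))))

-- Turns parities into congruences modulo `2 * c`: once a number is multiplied by `c`, only its
-- parity matters.
≋-scale₂ : ∀ c {a b} → a ≋ b [ 2 ] → c * a ≋ c * b [ 2 * c ]
≋-scale₂ c {a} {b} p = subst (λ M → c * a ≋ c * b [ M ]) (*-comm c 2) (≋-scale c p)

≋-*ˡ : ∀ {M a b} c → a ≋ b [ M ] → c * a ≋ c * b [ M ]
≋-*ˡ {M} c p = ≋-∣ (n∣m*n c {M}) (≋-scale c p)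

≋-drop : ∀ {M a b} → M ∣ b → a + b ≋ a [ M ]
≋-drop {a = a} (divides x b≡) = cong-by 0 x (trans (+-identityʳ _) (cong (a +_) b≡))

-- Odd numbers

odd-≋1 : ∀ {n} → 2 ∤ n → n ≋ 1 [ 2 ]
odd-≋1 {0} odd = ⊥-elim (odd (divides 0 refl))
odd-≋1 {1} odd = ≋-refl
odd-≋1 {suc (suc n)} odd = ≋-trans
  (≋-trans (≋-reflexive (+-comm 2 n)) (≋-drop (divides 1 refl)))
  (odd-≋1 (odd ∘ ∣m∣n⇒∣m+n (divides 1 refl)))

odd⇒1+2* : ∀ {n} → 2 ∤ n → ∃ λ γ → n ≡ suc (γ * 2)
odd⇒1+2* {0} odd = ⊥-elim (odd (divides 0 refl))
odd⇒1+2* {1} odd = 0 , refl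
odd⇒1+2* {suc (suc n)} odd =
  let γ , eq = odd⇒1+2* (odd ∘ ∣m∣n⇒∣m+n (divides 1 refl)) in suc γ , cong (λ k → suc (suc k)) eq

odd-* : ∀ {a b} → 2 ∤ a → 2 ∤ b → 2 ∤ a * b
odd-* {a} {b} odd-a odd-b 2∣ab = [ odd-a , odd-b ]′ (euclidsLemma a b prime[2] 2∣ab)

odd-^ : ∀ {a} k → 2 ∤ a → 2 ∤ a ^ k
odd-^ zero    odd-a 2∣1 with () ← ∣1⇒≡1 2∣1
odd-^ (suc k) odd-a = odd-* odd-a (odd-^ k odd-a)

-- Finite sums and symmetric double sums

∑ : ∀ {A : Set} → (A → ℕ) → List A → ℕ
∑ f xs = sum (map f xs)

module _ {A : Set} where

  ∑-≋ : ∀ {M} {f g : A → ℕ} → (∀ x → f x ≋ g x [ M ]) → ∀ xs → ∑ f xs ≋ ∑ g xs [ M ]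
  ∑-≋ f≋g []       = ≋-refl
  ∑-≋ f≋g (x ∷ xs) = ≋-+ (f≋g x) (∑-≋ f≋g xs)

  ∑-cong : ∀ {f g : A → ℕ} → f ≗ g → ∑ f ≗ ∑ g
  ∑-cong f≗g []       = refl
  ∑-cong f≗g (x ∷ xs) = cong₂ _+_ (f≗g x) (∑-cong f≗g xs)

  ∑-lin : ∀ c (f g : A → ℕ) xs → ∑ (λ x → f x + c * g x) xs ≡ ∑ f xs + c * ∑ g xs
  ∑-lin c f g []       = sym (*-zeroʳ c)
  ∑-lin c f g (x ∷ xs) = trans (cong (_+_ (f x + c * g x)) (∑-lin c f g xs))
                               (regroup (f x) (g x) (∑ f xs) (∑ g xs) c)
    where
    regroup : ∀ a b s t c → (a + c * b) + (s + c * t) ≡ (a + s) + c * (b + t)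
    regroup = solve-∀

  ∑-+ : ∀ (f g : A → ℕ) xs → ∑ (λ x → f x + g x) xs ≡ ∑ f xs + ∑ g xs
  ∑-+ f g []       = refl
  ∑-+ f g (x ∷ xs) = trans (cong (_+_ (f x + g x)) (∑-+ f g xs))
                           (regroup (f x) (g x) (∑ f xs) (∑ g xs))
    where
    regroup : ∀ a b s t → (a + b) + (s + t) ≡ (a + s) + (b + t)
    regroup = solve-∀

  ∑-zero : ∀ (xs : List A) → ∑ (λ _ → 0) xs ≡ 0
  ∑-zero []       = refl
  ∑-zero (x ∷ xs) = ∑-zero xs

  -- Off the diagonal, the entries at (x, y) and (y, x) are equal and cancel in pairs modulo 2. This
  -- serves both for the square of a geometric series and for pairs of complementary divisors.
  ∑∑-symmetric : ∀ (f : A → A → ℕ) → (∀ x y → f x y ≡ f y x) → ∀ xs →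
                 ∑ (λ x → ∑ (f x) xs) xs ≋ ∑ (λ x → f x x) xs [ 2 ]
  ∑∑-symmetric f f-sym []       = ≋-refl
  ∑∑-symmetric f f-sym (x ∷ xs) = begin
    (f x x + r) + ∑ (λ y → f y x + ∑ (f y) xs) xs
      ≡⟨ cong (_+_ (f x x + r)) (∑-+ (λ y → f y x) (λ y → ∑ (f y) xs) xs) ⟩
    (f x x + r) + (∑ (λ y → f y x) xs + d)
      ≡⟨ cong (λ c → (f x x + r) + (c + d)) (∑-cong (λ y → f-sym y x) xs) ⟩
    (f x x + r) + (r + d)
      ≡⟨ regroup (f x x) r d ⟩
    (f x x + d) + r * 2
      ≈⟨ ≋-drop (n∣m*n r) ⟩
    f x x + d
      ≈⟨ ≋-+ ≋-refl (∑∑-symmetric f f-sym xs) ⟩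
    f x x + ∑ (λ y → f y y) xs ∎
    where
    open ≋-Reasoning 2
    r d : ℕ
    r = ∑ (f x) xs
    d = ∑ (λ y → ∑ (f y) xs) xs
    regroup : ∀ a r d → (a + r) + (r + d) ≡ (a + d) + r * 2
    regroup = solve-∀

∑-upTo-single : ∀ (f : ℕ → ℕ) {n y} → y < n → (∀ x → x ≢ y → f x ≡ 0) → ∑ f (upTo n) ≡ f y
∑-upTo-single f {n} y<n off = trans (cong sum (map-upTo f n)) (go f y<n off)
  where
  vanish : ∀ (f : ℕ → ℕ) n → (∀ x → f x ≡ 0) → sum (applyUpTo f n) ≡ 0
  vanish f zero    f≡0 = refl
  vanish f (suc n) f≡0 = cong₂ _+_ (f≡0 0) (vanish (f ∘ suc) n (f≡0 ∘ suc))
  go : ∀ (f : ℕ → ℕ) {n y} → y < n → (∀ x → x ≢ y → f x ≡ 0) → sum (applyUpTo f n) ≡ f y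
  go f {suc n} {zero} _ off =
    trans (cong (f 0 +_) (vanish (f ∘ suc) n (λ x → off (suc x) λ ()))) (+-identityʳ (f 0))
  go f {suc n} {suc y} (s≤s y<n) off =
    trans (cong (_+ sum (applyUpTo (f ∘ suc) n)) (off 0 λ ()))
          (go (f ∘ suc) y<n (λ x x≢y → off (suc x) (x≢y ∘ suc-injective)))

-- Power series and their shifts

-- A formal power series in q, given by its coefficients.
Series : Set
Series = ℕ → ℕ

-- The series 1. Hence `shift k δ N` is the indicator of `k ≡ N`, through which partitions, divisors
-- and squares are counted.
δ : Series
δ zero    = 1
δ (suc _) = 0

-- Multiplication by q ^ k.
shift : ℕ → Series → Series
shift zero    f N       = f N
shift (suc k) f zero    = 0
shift (suc k) f (suc N) = shift k f N

shift-cong : ∀ k {f g : Series} → f ≗ g → shift k f ≗ shift k g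
shift-cong zero    f≗g N       = f≗g N
shift-cong (suc k) f≗g zero    = refl
shift-cong (suc k) f≗g (suc N) = shift-cong k f≗g N

shift-zero : ∀ k N → shift k (λ _ → 0) N ≡ 0
shift-zero zero    N       = refl
shift-zero (suc k) zero    = refl
shift-zero (suc k) (suc N) = shift-zero k N

shift-+ : ∀ k (f g : Series) N → shift k (λ j → f j + g j) N ≡ shift k f N + shift k g N
shift-+ zero    f g N       = refl
shift-+ (suc k) f g zero    = refl
shift-+ (suc k) f g (suc N) = shift-+ k f g N

shift-* : ∀ k c (f : Series) N → shift k (λ j → c * f j) N ≡ c * shift k f N
shift-* zero    c f N       = refl
shift-* (suc k) c f zero    = sym (*-zeroʳ c)
shift-* (suc k) c f (suc N) = shift-* k c f N

shift-∑ : ∀ {A : Set} k (f : A → Series) xs N →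
          shift k (λ j → ∑ (λ x → f x j) xs) N ≡ ∑ (λ x → shift k (f x) N) xs
shift-∑ zero    f xs N       = refl
shift-∑ (suc k) f xs zero    = sym (∑-zero xs)
shift-∑ (suc k) f xs (suc N) = shift-∑ k f xs N

shift-shift : ∀ k l (f : Series) N → shift k (shift l f) N ≡ shift (k + l) f N
shift-shift zero    l f N       = refl
shift-shift (suc k) l f zero    = refl
shift-shift (suc k) l f (suc N) = shift-shift k l f N

shift-cases : ∀ k (f : Series) N →
              shift k f N ≡ 0 ⊎ (∃ λ N′ → N ≡ k + N′ × shift k f N ≡ f N′)
shift-cases zero    f N       = inj₂ (N , refl , refl)
shift-cases (suc k) f zero    = inj₁ refl
shift-cases (suc k) f (suc N) with shift-cases k f N
... | inj₁ eq              = inj₁ eq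
... | inj₂ (N′ , N≡ , eq) = inj₂ (N′ , cong suc N≡ , eq)

shift-δ-same : ∀ k → shift k δ k ≡ 1
shift-δ-same zero    = refl
shift-δ-same (suc k) = shift-δ-same k

shift-δ-other : ∀ k N → k ≢ N → shift k δ N ≡ 0
shift-δ-other zero    zero    k≢N = ⊥-elim (k≢N refl)
shift-δ-other zero    (suc N) k≢N = refl
shift-δ-other (suc k) zero    k≢N = refl
shift-δ-other (suc k) (suc N) k≢N = shift-δ-other k N (k≢N ∘ cong suc)

δ-odd : ∀ {N} → 2 ∤ N → δ N ≡ 0
δ-odd {zero}  odd = ⊥-elim (odd (divides 0 refl))
δ-odd {suc N} odd = refl

-- Subtracting an even `k` from an odd exponent leaves an odd exponent.
shift-even-vanishes : ∀ {M k} {f : Series} → 2 ∣ k → (∀ N → 2 ∤ N → f N ≋ 0 [ M ]) →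
                      ∀ {N} → 2 ∤ N → shift k f N ≋ 0 [ M ]
shift-even-vanishes {k = k} {f} 2∣k f≋0 {N} odd with shift-cases k f N
... | inj₁ eq = ≋-reflexive eq
... | inj₂ (N′ , refl , eq) =
  ≋-trans (≋-reflexive eq) (f≋0 N′ (odd ∘ ∣m∣n⇒∣m+n 2∣k))

-- Linear operators and powers of 1 + 2eK

-- Factors of the generating function act as operators, so their powers are iterates and no product
-- of series has to be defined. Series are compared pointwise, hence the field `ext`.
record Linear (G : Series → Series) : Set where
  field
    ext : ∀ {f g} → f ≗ g → G f ≗ G g
    lin : ∀ c f g N → G (λ j → f j + c * g j) N ≡ G f N + c * G g N

  -- The witnesses of the congruences form two series `x` and `y`, and `G` is applied to the
  -- equation f + M x = g + M y.
  cong-≋ : ∀ {M f g} → (∀ N → f N ≋ g N [ M ]) → ∀ N → G f N ≋ G g N [ M ]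
  cong-≋ {M} {f} {g} f≋g N = cong-by (G x N) (G y N) (begin
    G f N + G x N * M          ≡⟨ cong (G f N +_) (*-comm (G x N) M) ⟩
    G f N + M * G x N          ≡⟨ lin M f x N ⟨
    G (λ j → f j + M * x j) N  ≡⟨ ext pointwise N ⟩
    G (λ j → g j + M * y j) N  ≡⟨ lin M g y N ⟩
    G g N + M * G y N          ≡⟨ cong (G g N +_) (*-comm M (G y N)) ⟩
    G g N + G y N * M          ∎)
    where
    open ≡-Reasoning
    x y : Series
    x j = _≋_[_].x (f≋g j)
    y j = _≋_[_].y (f≋g j)
    pointwise : ∀ j → f j + M * x j ≡ g j + M * y j
    pointwise j = trans (cong (f j +_) (*-comm M (x j)))
                 (trans (_≋_[_].eq (f≋g j)) (cong (g j +_) (*-comm (y j) M)))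

open Linear

-- (1 + 2e K)² = 1 + 4e (K + e K²)
squared : ℕ → (Series → Series) → Series → Series
squared e K f N = K f N + e * K (K f) N

squared-linear : ∀ e {K} → Linear K → Linear (squared e K)
squared-linear e {K} K-lin = record
  { ext = λ f≗g N → cong₂ (λ u v → u + e * v) (ext K-lin f≗g N) (ext K-lin (ext K-lin f≗g) N)
  ; lin = λ c f g N → trans
      (cong₂ (λ u v → u + e * v) (lin K-lin c f g N)
        (trans (ext K-lin (lin K-lin c f g) N) (lin K-lin c (K f) (K g) N)))
      (regroup (K f N) (K g N) (K (K f) N) (K (K g) N) c e)
  }
  where
  regroup : ∀ a b s t c e → (a + c * b) + e * (s + c * t) ≡ (a + e * s) + c * (b + e * t)
  regroup = solve-∀

-- With the coefficient written as `2 * e`, the square has the same shape with `2 * e` in place of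
-- `e`, so squaring can be iterated.
square : ∀ e {B K : Series → Series} → Linear K → (∀ f N → B f N ≡ f N + (2 * e) * K f N) →
         ∀ f N → B (B f) N ≡ f N + (2 * (2 * e)) * squared e K f N
square e {B} {K} K-lin B≡ f N = begin
  B (B f) N
    ≡⟨ B≡ (B f) N ⟩
  B f N + (2 * e) * K (B f) N
    ≡⟨ cong₂ (λ u v → u + (2 * e) * v) (B≡ f N)
         (trans (ext K-lin (B≡ f) N) (lin K-lin (2 * e) f (K f) N)) ⟩
  (f N + (2 * e) * K f N) + (2 * e) * (K f N + (2 * e) * K (K f) N)
    ≡⟨ regroup (f N) (K f N) (K (K f) N) e ⟩
  f N + (2 * (2 * e)) * squared e K f N ∎
  where
  open ≡-Reasoning
  regroup : ∀ a b c e → (a + (2 * e) * b) + (2 * e) * (b + (2 * e) * c)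
                      ≡ a + (2 * (2 * e)) * (b + e * c)
  regroup = solve-∀

-- The square of `B` is the identity modulo 4e, so an odd power of `B` agrees with `B` itself.
odd-power : ∀ e {B K : Series → Series} → Linear K → (∀ f N → B f N ≡ f N + (2 * e) * K f N) →
            ∀ γ f N → fold f B (suc (γ * 2)) N ≋ f N + (2 * e) * K f N [ 2 * (2 * e) ]
odd-power e {B} {K} K-lin B≡ γ f N = begin
  B (fold f B (γ * 2)) N                  ≡⟨ B≡ (fold f B (γ * 2)) N ⟩
  fold f B (γ * 2) N + (2 * e) * K (fold f B (γ * 2)) N
    ≈⟨ ≋-+ (even-power γ N) (≋-*ˡ (2 * e) (cong-≋ K-lin (even-power γ) N)) ⟩
  f N + (2 * e) * K f N                   ∎
  where
  open ≋-Reasoning (2 * (2 * e))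
  even-power : ∀ γ N → fold f B (γ * 2) N ≋ f N [ 2 * (2 * e) ]
  even-power zero    N = ≋-refl
  even-power (suc γ) N = begin
    B (B g) N                              ≡⟨ square e K-lin B≡ g N ⟩
    g N + (2 * (2 * e)) * squared e K g N  ≈⟨ ≋-drop (m∣m*n {2 * (2 * e)} (squared e K g N)) ⟩
    g N                                    ≈⟨ even-power γ N ⟩
    f N                                    ∎
    where
    g : Series
    g = fold f B (γ * 2)

fold-∘ : ∀ {A : Set} (z : A) (s : A → A) e m → fold z s (m * e) ≡ fold z (λ y → fold y s e) m
fold-∘ z s e zero    = refl
fold-∘ z s e (suc m) = trans (fold-+ z s e) (cong (λ y → fold y s e) (fold-∘ z s e m))

-- Repeated squaring. The first square gives K = G + G²; each later one adds e K² to K with `e`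
-- even, so K does not change modulo 2.
two-power : ∀ {A G : Series → Series} → Linear G → (∀ f N → A f N ≡ f N + 2 * G f N) → ∀ m →
            Σ (Series → Series) λ K →
              Linear K
            × (∀ f N → fold f A (2 ^ suc m) N ≡ f N + 2 ^ suc (suc m) * K f N)
            × (∀ f N → K f N ≋ G f N + G (G f) N [ 2 ])
two-power {A} {G} G-lin A≡ zero =
    squared 1 G
  , squared-linear 1 G-lin
  , square 1 {A} {G} G-lin A≡
  , λ f N → ≋-reflexive (cong (G f N +_) (*-identityˡ (G (G f) N)))
two-power {A} G-lin A≡ (suc m) =
  let K , K-lin , fold≡ , K≋ = two-power G-lin A≡ m
      e = 2 ^ suc m
  in  squared e K
    , squared-linear e K-lin
    , (λ f N → trans (cong (λ h → h N) (fold-∘ f A (2 ^ suc m) 2))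
                     (square e {λ g → fold g A (2 ^ suc m)} {K} K-lin fold≡ f N))
    , λ f N → ≋-trans (≋-drop (∣m⇒∣m*n (K (K f) N) (m∣m*n {2} (2 ^ m)))) (K≋ f N)

-- The factor contributed by one part

module _ (n i : ℕ) where

  -- q^i + q^2i + … + q^ni, as a multiplication operator
  geometric : Series → Series
  geometric f N = ∑ (λ t → shift (suc t * i) f N) (upTo n)

  -- The 2 stands for the choice whether the first occurrence is overlined.
  overlinedPart : Series → Series
  overlinedPart f N = f N + 2 * geometric f N

  geometric-linear : Linear geometric
  geometric-linear = record
    { ext = λ f≗g N → ∑-cong (λ t → shift-cong (suc t * i) f≗g N) (upTo n)
    ; lin = λ c f g N → trans
        (∑-cong (λ t → trans (shift-+ (suc t * i) f (λ j → c * g j) N)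
                             (cong (_+_ (shift (suc t * i) f N)) (shift-* (suc t * i) c g N))) (upTo n))
        (∑-lin c (λ t → shift (suc t * i) f N) (λ t → shift (suc t * i) g N) (upTo n))
    }

  geometric-even-vanishes : ∀ {M f} → 2 ∣ i → (∀ N → 2 ∤ N → f N ≋ 0 [ M ]) →
                            ∀ {N} → 2 ∤ N → geometric f N ≋ 0 [ M ]
  geometric-even-vanishes 2∣i f≋0 odd = ≋-trans
    (∑-≋ (λ t → shift-even-vanishes (∣n⇒∣m*n (suc t) 2∣i) f≋0 odd) (upTo n))
    (≋-reflexive (∑-zero (upTo n)))

  -- The square is the sum of q^((t+u)i), symmetric in t and u. Modulo 2 only the terms q^(2ti)
  -- remain, and their exponents are even.
  geometric²δ-vanishes : ∀ {N} → 2 ∤ N → geometric (geometric δ) N ≋ 0 [ 2 ]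
  geometric²δ-vanishes {N} odd = begin
    geometric (geometric δ) N
      ≡⟨ ∑-cong (λ t → trans (shift-∑ (suc t * i) (λ u → shift (suc u * i) δ) (upTo n) N)
                             (∑-cong (λ u → shift-shift (suc t * i) (suc u * i) δ N) (upTo n)))
                (upTo n) ⟩
    ∑ (λ t → ∑ (λ u → shift (suc t * i + suc u * i) δ N) (upTo n)) (upTo n)
      ≈⟨ ∑∑-symmetric (λ t u → shift (suc t * i + suc u * i) δ N)
           (λ t u → cong (λ k → shift k δ N) (+-comm (suc t * i) (suc u * i))) (upTo n) ⟩
    ∑ (λ t → shift (suc t * i + suc t * i) δ N) (upTo n)
      ≈⟨ ∑-≋ (λ t → shift-even-vanishes (divides (suc t * i) (double (suc t * i)))
                      (λ N odd → ≋-reflexive (δ-odd odd)) odd) (upTo n) ⟩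
    ∑ (λ _ → 0) (upTo n)
      ≡⟨ ∑-zero (upTo n) ⟩
    0 ∎
    where
    open ≋-Reasoning 2
    double : ∀ a → a + a ≡ a * 2
    double = solve-∀

-- Generating functions of lists of partitions

module _ {s : ℕ} where

  count : List (List (Part s × Occurrence)) → Series
  count πs N = length (filter (λ π → weight π ≟ N) πs)

  count-∷ : ∀ π πs N → count (π ∷ πs) N ≡ shift (weight π) δ N + count πs N
  count-∷ π πs N with weight π ≟ N
  ... | yes refl = trans (cong length (filter-accept (λ ρ → weight ρ ≟ N) {π} {πs} refl))
                         (cong (_+ count πs N) (sym (shift-δ-same N)))
  ... | no  w≢N  = trans (cong length (filter-reject (λ ρ → weight ρ ≟ N) {π} {πs} w≢N))
                         (cong (_+ count πs N) (sym (shift-δ-other (weight π) N w≢N)))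

  count-++ : ∀ πs ρs N → count (πs ++ ρs) N ≡ count πs N + count ρs N
  count-++ πs ρs N = trans (cong length (filter-++ (λ π → weight π ≟ N) πs ρs))
                           (length-++ (filter (λ π → weight π ≟ N) πs))

  count-map-∷ : ∀ (p : Part s) o πs N →
                count (map (λ π → (p , o) ∷ π) πs) N ≡ shift (multiplicity o * proj₁ p) (count πs) N
  count-map-∷ p o []       N = sym (shift-zero (multiplicity o * proj₁ p) N)
  count-map-∷ p o (π ∷ πs) N = begin
    count (map (λ π → (p , o) ∷ π) (π ∷ πs)) N
      ≡⟨ count-∷ ((p , o) ∷ π) (map (λ π → (p , o) ∷ π) πs) N ⟩
    shift (k + weight π) δ N + count (map (λ π → (p , o) ∷ π) πs) N
      ≡⟨ cong₂ _+_ (sym (shift-shift k (weight π) δ N)) (count-map-∷ p o πs N) ⟩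
    shift k (shift (weight π) δ) N + shift k (count πs) N
      ≡⟨ shift-+ k (shift (weight π) δ) (count πs) N ⟨
    shift k (λ j → shift (weight π) δ j + count πs j) N
      ≡⟨ shift-cong k (λ j → sym (count-∷ π πs j)) N ⟩
    shift k (count (π ∷ πs)) N ∎
    where
    open ≡-Reasoning
    k : ℕ
    k = multiplicity o * proj₁ p

  count-product : ∀ (p : Part s) os πs N →
    count (cartesianProductWith (λ o π → (p , o) ∷ π) os πs) N
      ≡ ∑ (λ o → shift (multiplicity o * proj₁ p) (count πs) N) os
  count-product p []       πs N = refl
  count-product p (o ∷ os) πs N = trans
    (count-++ (map (λ π → (p , o) ∷ π) πs) _ N)
    (cong₂ _+_ (count-map-∷ p o πs N) (count-product p os πs N))

  -- The occurrence `absent` gives the summand 1; each positive multiplicity is listed twice,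
  -- overlined and not, which gives 2 G.
  count-choices-∷ : ∀ n (p : Part s) ps →
    count (choices n (p ∷ ps)) ≗ overlinedPart n (proj₁ p) (count (choices n ps))
  count-choices-∷ n p ps N = trans
    (count-product p (occurrences n) (choices n ps) N)
    (cong (count (choices n ps) N +_) (∑-occurs (upTo n)))
    where
    h : ℕ → ℕ
    h k = shift (k * proj₁ p) (count (choices n ps)) N
    ∑-occurs : ∀ ts → ∑ (h ∘ multiplicity) (cartesianProductWith occurs ts (true ∷ false ∷ []))
                    ≡ 2 * ∑ (h ∘ suc) ts
    ∑-occurs []       = refl
    ∑-occurs (t ∷ ts) = trans (cong (λ r → h (suc t) + (h (suc t) + r)) (∑-occurs ts))
                              (regroup (h (suc t)) (∑ (h ∘ suc) ts))
      where
      regroup : ∀ a r → a + (a + 2 * r) ≡ 2 * (a + r)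
      regroup = solve-∀

overlinedPart-ext : ∀ n i {f g} → f ≗ g → overlinedPart n i f ≗ overlinedPart n i g
overlinedPart-ext n i f≗g N =
  cong₂ (λ u v → u + 2 * v) (f≗g N) (ext (geometric-linear n i) f≗g N)

partsOfSizes : ∀ s → List ℕ → List (Part s)
partsOfSizes s = concatMap (λ i → map (i ,_) (allFin (colours s i)))

-- For the sizes 1, ..., n the coefficient at `n` is `ā s n` by definition. The list of sizes is a
-- parameter so that induction can run over it, while `n` stays fixed as the bound on
-- multiplicities.
generating : ∀ s n → List ℕ → Series
generating s n is = count (choices n (partsOfSizes s is))

generating-[] : ∀ s n → generating s n [] ≗ δ
generating-[] s n zero    = refl
generating-[] s n (suc N) = refl

-- All colours of one size contribute the same factor, so only the number of colours enters.
generating-∷ : ∀ s n i is →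
  generating s n (i ∷ is) ≗ fold (generating s n is) (overlinedPart n i) (colours s i)
generating-∷ s n i is N = trans (go (allFin (colours s i)) N)
  (cong (λ c → fold (generating s n is) (overlinedPart n i) c N) (length-tabulate {n = colours s i} id))
  where
  go : ∀ (cs : List (Fin (colours s i))) →
       count (choices n (map (i ,_) cs ++ partsOfSizes s is))
         ≗ fold (generating s n is) (overlinedPart n i) (length cs)
  go []       N = refl
  go (c ∷ cs) N = trans
    (count-choices-∷ n (i , c) (map (i ,_) cs ++ partsOfSizes s is) N)
    (overlinedPart-ext n i (go cs) N)

colours-even : ∀ s {i} → 2 ∣ i → colours s i ≡ 1
colours-even s {i} 2∣i = cong (if_then 1 else s) (dec-true (2 ∣? i) 2∣i)

colours-odd : ∀ s {i} → 2 ∤ i → colours s i ≡ s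
colours-odd s {i} odd = cong (if_then 1 else s) (dec-false (2 ∣? i) odd)

-- Reduction modulo 4 and modulo 2^(m+2)

-- At N ≥ 1: the number of pairs (t , i) with i in the list, 1 ≤ t ≤ n and t * i ≡ N.
divisorCount : ℕ → List ℕ → Series
divisorCount n is N = ∑ (λ i → geometric n i δ N) is

-- Each size contributes an odd power of 1 + 2 G, which is 1 + 2 G modulo 4. The remaining series
-- `f` is 1 modulo 2, so 2 G f may be replaced by 2 G, and the product becomes a sum.
generating-mod4 : ∀ β n is N →
  generating (suc (β * 2)) n is N ≋ δ N + 2 * divisorCount n is N [ 4 ]
generating-mod4 β n []       N = ≋-reflexive
  (trans (generating-[] (suc (β * 2)) n N) (sym (+-identityʳ (δ N))))
generating-mod4 β n (i ∷ is) N = begin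
  generating s n (i ∷ is) N
    ≡⟨ generating-∷ s n i is N ⟩
  fold f (overlinedPart n i) (colours s i) N
    ≡⟨ cong (λ c → fold f (overlinedPart n i) c N) (proj₂ colours-form) ⟩
  fold f (overlinedPart n i) (suc (proj₁ colours-form * 2)) N
    ≈⟨ odd-power 1 (geometric-linear n i) (λ _ _ → refl) (proj₁ colours-form) f N ⟩
  f N + 2 * geometric n i f N
    ≈⟨ ≋-+ (generating-mod4 β n is N)
           (≋-scale 2 (cong-≋ (geometric-linear n i) f≋δ N)) ⟩
  (δ N + 2 * divisorCount n is N) + 2 * geometric n i δ N
    ≡⟨ regroup (δ N) (divisorCount n is N) (geometric n i δ N) ⟩
  δ N + 2 * divisorCount n (i ∷ is) N ∎
  where
  open ≋-Reasoning 4
  s : ℕ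
  s = suc (β * 2)
  f : Series
  f = generating s n is
  -- Even sizes have one colour and odd sizes `suc (β * 2)`: an odd number in both cases.
  colours-form : ∃ λ γ → colours s i ≡ suc (γ * 2)
  colours-form with 2 ∣? i
  ... | yes 2∣i = 0 , colours-even s 2∣i
  ... | no  2∤i = β , colours-odd s 2∤i
  f≋δ : ∀ N → f N ≋ δ N [ 2 ]
  f≋δ N = ≋-trans (≋-∣ (divides 2 refl) (generating-mod4 β n is N)) (≋-drop (m∣m*n {2} (divisorCount n is N)))
  regroup : ∀ a d g → (a + 2 * d) + 2 * g ≡ a + 2 * (g + d)
  regroup = solve-∀

module _ (m γ n : ℕ) where

  private
    -- Here `suc m` is the exponent of 2 in the theorem, so that `2 * c` is the modulus there.
    c s : ℕ
    c = 2 ^ suc (suc m)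
    s = suc (γ * 2) * 2 ^ suc m

  -- The power `s` is split as an odd power of a power with exponent `2 ^ suc m`. The correction
  -- term carries the factor `c`, so `f` and the operator K are needed only modulo 2.
  odd-size-step : ∀ i f → (∀ N → f N ≋ δ N [ 2 ]) → ∀ N →
    fold f (overlinedPart n i) s N
      ≋ f N + c * (geometric n i δ N + geometric n i (geometric n i δ) N) [ 2 * c ]
  odd-size-step i f f≋δ N =
    let G-lin = geometric-linear n i
        K , K-lin , fold≡ , K≋ = two-power {overlinedPart n i} G-lin (λ _ _ → refl) m
    in begin
    fold f (overlinedPart n i) s N
      ≡⟨ cong (λ h → h N) (fold-∘ f (overlinedPart n i) (2 ^ suc m) (suc (γ * 2))) ⟩
    fold f (λ g → fold g (overlinedPart n i) (2 ^ suc m)) (suc (γ * 2)) N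
      ≈⟨ odd-power (2 ^ suc m) K-lin fold≡ γ f N ⟩
    f N + c * K f N
      ≈⟨ ≋-+ (≋-refl {a = f N}) (≋-scale₂ c (≋-trans (cong-≋ K-lin f≋δ N) (K≋ δ N))) ⟩
    f N + c * (geometric n i δ N + geometric n i (geometric n i δ) N) ∎
    where
    open ≋-Reasoning (2 * c)

  -- The two claims support each other in the induction: the first lets an odd size act on `δ`
  -- instead of `f`, and the second makes `f` vanish modulo `c` at odd exponents, which handles the
  -- even sizes.
  generating-invariant : ∀ is →
      (∀ N → generating s n is N ≋ δ N [ 2 ])
    × (∀ N → 2 ∤ N → generating s n is N ≋ c * divisorCount n is N [ 2 * c ])
  generating-invariant [] =
      (λ N → ≋-reflexive (generating-[] s n N))
    , λ N odd → ≋-reflexive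
        (trans (generating-[] s n N) (trans (δ-odd odd) (sym (*-zeroʳ c))))
  generating-invariant (i ∷ is) with generating-invariant is | 2 ∣? i
  ... | f≋δ , f-odd | yes 2∣i =
      parity
    , λ N odd → let open ≋-Reasoning (2 * c) in begin
        generating s n (i ∷ is) N
          ≡⟨ step N ⟩
        f N + 2 * geometric n i f N
          -- At odd exponents `f` is divisible by `c`, and an even size preserves this; the factor 2
          -- raises it to divisibility by `2 * c`.
          ≈⟨ ≋-+ (f-odd N odd) (≋-scale 2 (geometric-even-vanishes n i 2∣i f≋0 odd)) ⟩
        c * divisorCount n is N + 0
          ≡⟨ +-identityʳ _ ⟩
        c * divisorCount n is N
          -- An even `i` divides no odd `N`, so it adds nothing to the divisor count.
          ≈⟨ ≋-scale₂ c (≋-+ (geometric-even-vanishes n i 2∣i (λ N odd → ≋-reflexive (δ-odd odd)) odd) ≋-refl) ⟨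
        c * divisorCount n (i ∷ is) N ∎
    where
    f : Series
    f = generating s n is
    step : ∀ N → generating s n (i ∷ is) N ≡ f N + 2 * geometric n i f N
    step N = trans (generating-∷ s n i is N)
                   (cong (λ e → fold f (overlinedPart n i) e N) (colours-even s 2∣i))
    parity : ∀ N → generating s n (i ∷ is) N ≋ δ N [ 2 ]
    parity N = ≋-trans (≋-reflexive (step N))
                       (≋-trans (≋-drop (m∣m*n {2} (geometric n i f N))) (f≋δ N))
    f≋0 : ∀ N → 2 ∤ N → f N ≋ 0 [ c ]
    f≋0 N odd = ≋-trans (≋-∣ (n∣m*n 2) (f-odd N odd)) (≋-drop (m∣m*n {c} (divisorCount n is N)))
  ... | f≋δ , f-odd | no 2∤i =
      (λ N → ≋-trans (≋-∣ (m∣m*n {2} c) (step N))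
              (≋-trans (≋-drop (∣m⇒∣m*n (geometric n i δ N + geometric n i (geometric n i δ) N)
                                        (m∣m*n {2} (2 ^ suc m))))
                       (f≋δ N)))
    , λ N odd → let open ≋-Reasoning (2 * c) in begin
        generating s n (i ∷ is) N
          ≈⟨ step N ⟩
        f N + c * (geometric n i δ N + geometric n i (geometric n i δ) N)
          ≈⟨ ≋-+ (f-odd N odd) (≋-scale₂ c (≋-+ (≋-refl {a = geometric n i δ N}) (geometric²δ-vanishes n i odd))) ⟩
        c * divisorCount n is N + c * (geometric n i δ N + 0)
          ≡⟨ regroup c (divisorCount n is N) (geometric n i δ N) ⟩
        c * divisorCount n (i ∷ is) N ∎
    where
    f : Series
    f = generating s n is
    step : ∀ N → generating s n (i ∷ is) N
               ≋ f N + c * (geometric n i δ N + geometric n i (geometric n i δ) N) [ 2 * c ]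
    step N = ≋-trans
      (≋-reflexive (trans (generating-∷ s n i is N)
                          (cong (λ e → fold f (overlinedPart n i) e N) (colours-odd s 2∤i))))
      (odd-size-step i f f≋δ N)
    regroup : ∀ c d g → c * d + c * (g + 0) ≡ c * (g + d)
    regroup = solve-∀

-- Squares and the parity of the divisor count

-- The indicator of the positive squares, written as the diagonal of the double sum over pairs of
-- complementary divisors.
squareCount : ℕ → ℕ
squareCount N = ∑ (λ x → shift (suc x * suc x) δ N) (upTo N)

-- Transposing a divisor with its codivisor leaves only the square roots.
divisorCount-parity : ∀ N → divisorCount N (map suc (upTo N)) N ≋ squareCount N [ 2 ]
divisorCount-parity N = ≋-trans
  (≋-reflexive (cong sum (sym (map-∘ (upTo N)))))
  (∑∑-symmetric (λ x y → shift (suc y * suc x) δ N)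
                (λ x y → cong (λ k → shift k δ N) (*-comm (suc y) (suc x))) (upTo N))

PositiveSquare : ℕ → Set
PositiveSquare N = ∃ λ x → N ≡ suc x * suc x

m*m≡n*n⇒m≡n : ∀ m n → m * m ≡ n * n → m ≡ n
m*m≡n*n⇒m≡n m n eq with <-cmp m n
... | tri< m<n _ _ = ⊥-elim (<⇒≢ (*-mono-< m<n m<n) eq)
... | tri≈ _ m≡n _ = m≡n
... | tri> _ _ n<m = ⊥-elim (<⇒≢ (*-mono-< n<m n<m) (sym eq))

squareCount-square : ∀ {N} → PositiveSquare N → squareCount N ≡ 1
squareCount-square (x , refl) = trans
  (∑-upTo-single (λ y → shift (suc y * suc y) δ (suc x * suc x)) (m≤m*n (suc x) (suc x))
    (λ y y≢x → shift-δ-other (suc y * suc y) _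
      (y≢x ∘ suc-injective ∘ m*m≡n*n⇒m≡n (suc y) (suc x))))
  (shift-δ-same (suc x * suc x))

squareCount-nonsquare : ∀ {N} → ¬ PositiveSquare N → squareCount N ≡ 0
squareCount-nonsquare {N} ¬sq = trans
  (∑-cong (λ x → shift-δ-other (suc x * suc x) N (λ eq → ¬sq (x , sym eq))) (upTo N))
  (∑-zero (upTo N))

positiveSquare? : ∀ N → Dec (PositiveSquare N)
positiveSquare? N = map′
  (λ (x , _ , eq) → x , eq)
  -- A positive root is at most its square, so the search below `N` misses none.
  (λ { (x , refl) → x , m≤m*n (suc x) (suc x) , refl })
  (anyUpTo? (λ x → N ≟ suc x * suc x) N)

-- If p² N is a square, Euclid's lemma shows that p divides its root, and p² can be cancelled;
-- conversely p times a root of N is a root of p² N.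
squareCount-p² : ∀ {p} → Prime p → ∀ N → squareCount (p ^ 2 * N) ≡ squareCount N
squareCount-p² {zero}   p-prime N = ⊥-elim (NonZero.nonZero (prime⇒nonZero p-prime))
squareCount-p² {suc p′} p-prime N with positiveSquare? N
... | yes (x , refl) = trans
        -- The successor of this witness is `p * suc x` by computation.
        (squareCount-square (x + p′ * suc x , rearrange p (suc x)))
        (sym (squareCount-square (x , refl)))
  where
  p : ℕ
  p = suc p′
  rearrange : ∀ p y → p * (p * 1) * (y * y) ≡ (p * y) * (p * y)
  rearrange = solve-∀
... | no ¬sq = trans (squareCount-nonsquare (¬sq ∘ descend)) (sym (squareCount-nonsquare ¬sq))
  where
  p : ℕ
  p = suc p′
  split : ∀ p N → p * (p * 1) * N ≡ (p * N) * p
  split = solve-∀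
  rearrange : ∀ z p → (z * p) * (z * p) ≡ p * (p * 1) * (z * z)
  rearrange = solve-∀
  descend : PositiveSquare (p ^ 2 * N) → PositiveSquare N
  descend (x , eq) with reduce (euclidsLemma (suc x) (suc x) p-prime
    (divides (p * N) (trans (sym eq) (split p N))))
  ... | divides (suc z) x≡zp = z , *-cancelˡ-≡ N (suc z * suc z) (p ^ 2)
          (trans eq (trans (cong₂ _*_ x≡zp x≡zp) (rearrange (suc z) p)))

squareCount-p²^k : ∀ {p} → Prime p → ∀ k N → squareCount ((p ^ 2) ^ k * N) ≡ squareCount N
squareCount-p²^k p-prime zero    N = cong squareCount (*-identityˡ N)
squareCount-p²^k {p} p-prime (suc k) N = trans
  (cong squareCount (*-assoc (p ^ 2) ((p ^ 2) ^ k) N))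
  (trans (squareCount-p² p-prime ((p ^ 2) ^ k * N)) (squareCount-p²^k p-prime k N))

-- The coefficients at odd exponents and the congruences

ā-2^α : ∀ m γ {N} → 2 ∤ N →
  ā (suc (γ * 2) * 2 ^ suc m) N ≋ 2 ^ suc (suc m) * squareCount N [ 2 * 2 ^ suc (suc m) ]
ā-2^α m γ {N} odd = ≋-trans
  (proj₂ (generating-invariant m γ N (map suc (upTo N))) N odd)
  (≋-scale₂ (2 ^ suc (suc m)) (divisorCount-parity N))

ā-odd : ∀ β {N} → 2 ∤ N → ā (suc (β * 2)) N ≋ 2 * squareCount N [ 4 ]
ā-odd β {N} odd = ≋-trans
  (generating-mod4 β N (map suc (upTo N)) N)
  (≋-+ (≋-reflexive (δ-odd odd)) (≋-scale₂ 2 (divisorCount-parity N)))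

-- Multiplying the argument by the square P leaves `squareCount` unchanged. The factor P on the
-- right is odd, hence 1 modulo 2, and is invisible modulo `2 * c` next to the factor `c`.
square-supported⇒p²^k-homogeneous : ∀ c (a : ℕ → ℕ) →
  (∀ {N} → 2 ∤ N → a N ≋ c * squareCount N [ 2 * c ]) →
  ∀ {p} → Prime p → 2 ∤ p → ∀ k {N} → 2 ∤ N →
  a ((p ^ 2) ^ k * N) ≋ (p ^ 2) ^ k * a N [ 2 * c ]
square-supported⇒p²^k-homogeneous c a a≋ {p} p-prime odd-p k {N} odd = begin
  a (P * N)                    ≈⟨ a≋ (odd-* odd-P odd) ⟩
  c * squareCount (P * N)      ≡⟨ cong (c *_) (squareCount-p²^k p-prime k N) ⟩
  c * squareCount N            ≡⟨ *-identityʳ _ ⟨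
  c * squareCount N * 1        ≡⟨ *-assoc c (squareCount N) 1 ⟩
  c * (squareCount N * 1)      ≈⟨ ≋-scale₂ c (≋-*ˡ (squareCount N) (odd-≋1 odd-P)) ⟨
  c * (squareCount N * P)      ≡⟨ rearrange c (squareCount N) P ⟩
  P * (c * squareCount N)      ≈⟨ ≋-*ˡ P (a≋ odd) ⟨
  P * a N                      ∎
  where
  open ≋-Reasoning (2 * c)
  P : ℕ
  P = (p ^ 2) ^ k
  odd-P : 2 ∤ P
  odd-P = odd-^ k (odd-^ 2 odd-p)
  rearrange : ∀ c s P → c * (s * P) ≡ P * (c * s)
  rearrange = solve-∀

odd-prime : ∀ {p} → Prime p → 3 ≤ p → 2 ∤ p
odd-prime p-prime 3≤p 2∣p with prime⇒irreducible p-prime 2∣p | 3≤p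
... | inj₂ refl | s≤s (s≤s ())

corollary1p5 : ∀ (k m α β p : ℕ) → 1 ≤ m → 1 ≤ α → 1 ≤ β → 2 ∤ α →
    Prime p → 3 ≤ p → p ≡ 3 [mod 4 ] →
    ∀ (n : ℕ) →
    (ā (2 ^ m * α) (4 * p ^ (2 * k) * n + p ^ (2 * k))
    ≡ (p ^ 2) ^ k * ā (2 ^ m * α) (4 * n + 1) [mod 2 ^ (m + 2) ])
    ×
    (ā (2 * β + 1) (4 * p ^ (2 * k) * n + p ^ (2 * k))
    ≡ (p ^ 2) ^ k * ā (2 * β + 1) (4 * n + 1) [mod 4 ])
corollary1p5 k (suc m) α β p _ _ _ odd-α p-prime 3≤p _ n =
    ≋⇒≡mod (subst (λ M → ā (2 ^ suc m * α) N′ ≋ (p ^ 2) ^ k * ā (2 ^ suc m * α) (4 * n + 1) [ M ])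
      -- The modulus `2 * c` for `c = 2 ^ suc (suc m)` is `2 ^ (2 + suc m)` by computation.
      (cong (2 ^_) (+-comm 2 (suc m)))
      (homogeneous (2 ^ suc (suc m)) (2 ^ suc m * α) λ {N} odd →
        subst (λ s → ā s N ≋ 2 ^ suc (suc m) * squareCount N [ 2 * 2 ^ suc (suc m) ])
              (sym s≡) (ā-2^α m γ odd)))
  -- Here `c` is 2, which gives the modulus 4.
  , ≋⇒≡mod (homogeneous 2 (2 * β + 1) λ {N} odd →
      subst (λ s → ā s N ≋ 2 * squareCount N [ 4 ]) (2β+1 β) (ā-odd β odd))
  where
  γ N′ : ℕ
  N′ = 4 * p ^ (2 * k) * n + p ^ (2 * k)
  γ = proj₁ (odd⇒1+2* odd-α)
  s≡ : 2 ^ suc m * α ≡ suc (γ * 2) * 2 ^ suc m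
  s≡ = trans (*-comm (2 ^ suc m) α) (cong (_* 2 ^ suc m) (proj₂ (odd⇒1+2* odd-α)))
  2β+1 : ∀ β → suc (β * 2) ≡ 2 * β + 1
  2β+1 = solve-∀
  halve : ∀ n → 4 * n ≡ 2 * n * 2
  halve = solve-∀
  odd-4n+1 : 2 ∤ 4 * n + 1
  odd-4n+1 2∣4n+1 with () ← ∣1⇒≡1 (∣m+n∣m⇒∣n 2∣4n+1 (divides (2 * n) (halve n)))
  factor : ∀ P n → P * (4 * n + 1) ≡ 4 * P * n + P
  factor = solve-∀
  -- The argument on the left of the theorem is the odd square (p²)^k times the odd number 4n + 1.
  index : (p ^ 2) ^ k * (4 * n + 1) ≡ 4 * p ^ (2 * k) * n + p ^ (2 * k)
  index = trans (factor ((p ^ 2) ^ k) n) (cong (λ P → 4 * P * n + P) (^-*-assoc p 2 k))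
  homogeneous : ∀ c s → (∀ {N} → 2 ∤ N → ā s N ≋ c * squareCount N [ 2 * c ]) →
    ā s (4 * p ^ (2 * k) * n + p ^ (2 * k)) ≋ (p ^ 2) ^ k * ā s (4 * n + 1) [ 2 * c ]
  homogeneous c s ā≋ = subst (λ N → ā s N ≋ (p ^ 2) ^ k * ā s (4 * n + 1) [ 2 * c ]) index
    (square-supported⇒p²^k-homogeneous c (ā s) ā≋ p-prime (odd-prime p-prime 3≤p) k odd-4n+1)
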